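{- The component twin-width of $A_3^h$ is $\Omega(h/\log h)$, i.e., there is an absolute constant $c>0$ such that $\mathrm{ctww}(A_3^h)\geq c\,h/\log h$ for all sufficiently large $h$.
   Context: Let $T$ be the complete ternary tree of depth $h$. The level of a node is $h$ minus its depth (leaves have level $0$). At each level $l$, the nodes are numbered $a_l^1,a_l^2,\dots$ from left to right. Two nodes $a_l^i,a_l^j$ at the same level $l$ are $l$-linked if $|j-i|=3$. The graph $A_3^h$ has as vertex set the $3^h$ leaves of $T$, and two leaves $u,v$ are adjacent iff there is a level $l$ and (non-strict) ancestors $a_l^i$ of $u$ and $a_l^j$ of $v$ that are $l$-linked. A partition sequence of an $n$-vertex graph $G$ is a sequence $\mathcal P_n,\dots,\mathcal P_1$ of partitions of $V(G)$ with $\mathcal P_n$ the singleton partition, $\mathcal P_1=\{V(G)\}$, each $\mathcal P_i$ obtained from $\mathcal P_{i+1}$ by merging two parts. Distinct parts $X,Y$ are inhomogeneous if there are $u,u'\in X$, $v,v'\in Y$ with $uv\in E(G)$, $u'v'\notin E(G)$; the red graph $\mathcal R(\mathcal P)$ has vertex set $\mathcal P$ and edges between inhomogeneous parts. The component twin-width $\mathrm{ctww}(G)$ is the minimum over partition sequences of the maximum, over $i$, of the number of vertices of a largest connected component of $\mathcal R(\mathcal P_i)$. -}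

module Defs where

open import Data.Nat using (ℕ; zero; suc; _+_; _*_; _∸_; _^_; _≤_; _<_; _/_)
open import Data.Nat.Logarithm using (⌈log₂_⌉)
open import Data.Fin using (Fin; toℕ)
open import Data.Product using (Σ; ∃; ∃-syntax; _×_; _,_)
open import Data.Sum using (_⊎_)
open import Relation.Nullary using (¬_)
open import Relation.Binary.PropositionalEquality using (_≡_)
open import Relation.Binary.Construct.Closure.ReflexiveTransitive using (Star)
open import Function.Bundles using (_⇔_)

record Graph (n : ℕ) : Set₁ where
  field
    Adj : Fin n → Fin n → Set

open Graph public

-- The graph A_3^h.
-- Leaves of the complete ternary tree of depth h are numbered
-- 0 .. 3^h - 1 from left to right.  The (non-strict) ancestor of leaf x
-- at level l is node number ⌊x / 3^l⌋ (0-based) at level l.  Two nodes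
-- at the same level are l-linked iff their indices differ by exactly 3.

Dist3 : ℕ → ℕ → Set
Dist3 i j = (i ≡ j + 3) ⊎ (j ≡ i + 3)

anc : ℕ → ℕ → ℕ
anc zero    x = x
anc (suc l) x = anc l x / 3

A3 : (h : ℕ) → Graph (3 ^ h)
A3 h = record
  { Adj = λ u v → ∃[ l ] (l ≤ h × Dist3 (anc l (toℕ u)) (anc l (toℕ v))) }

-- Partition sequences.
-- A partition of Fin n is given by a labelling Fin n → ℕ; the parts are
-- the (nonempty) label classes.  We index the sequence by the number k
-- of merges performed so far: stage k is the partition P_{n-k} of the
-- paper, for k = 0 .. n-1.

record PartitionSequence (n : ℕ) : Set where
  field
    lab : ℕ → Fin n → ℕ

  Same : ℕ → Fin n → Fin n → Set
  Same k u v = lab k u ≡ lab k v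

  field
    start  : ∀ u v → Same 0 u v → u ≡ v
    finish : ∀ u v → Same (n ∸ 1) u v
    merge  : ∀ k → suc k < n → ∃[ a ] ∃[ b ]
               (¬ Same k a b ×
                (∀ u v → Same (suc k) u v ⇔
                   (Same k u v ⊎ (Same k u a × Same k v b)
                               ⊎ (Same k u b × Same k v a))))

open PartitionSequence public

module _ {n : ℕ} (G : Graph n) (P : PartitionSequence n) (k : ℕ) where

  Red : Fin n → Fin n → Set
  Red x y = ¬ Same P k x y ×
    ∃[ u ] ∃[ u' ] ∃[ v ] ∃[ v' ]
      (Same P k u x × Same P k u' x × Same P k v y × Same P k v' y ×
       Adj G u v × ¬ Adj G u' v')

  -- The red graph R(P_{n-k}) has a connected component with at least m
  -- vertices (parts): there are m vertices of G lying in pairwise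
  -- distinct parts, any two of whose parts are joined by a red path.
  HasRedComponentOfSize : ℕ → Set
  HasRedComponentOfSize m = Σ (Fin m → Fin n) λ f → (
    (∀ (i j : Fin m) → ¬ i ≡ j → ¬ Same P k (f i) (f j)) ×
    (∀ (i j : Fin m) → Star Red (f i) (f j)))

-- ctww(G) ≥ p·h / (q·⌈log₂ h⌉): every partition sequence has a stage
-- whose red graph has a component of size m with p·h ≤ q·m·⌈log₂ h⌉.

module Submission where

open import Defs
open import Data.Nat using (ℕ; zero; suc; _+_; _*_; _^_; _≤_; _<_)
open import Data.Nat.Logarithm using (⌈log₂_⌉)
open import Data.Product using (Σ; ∃; ∃-syntax; _×_; _,_)

open import Algebra.Properties.CommutativeSemigroup using (interchange; x∙yz≈y∙xz)
open import Data.Bool using (Bool; true; false; not; _∧_; _∨_; T)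
open import Data.Empty using (⊥)
open import Data.Fin using (Fin; zero; suc; toℕ; fromℕ<; punchIn)
import Data.Fin.Properties as Fin
open import Data.Fin.Properties
  using (any?; toℕ<n; toℕ-fromℕ<; fromℕ<-toℕ; toℕ-injective; punchIn-injective; punchInᵢ≢i)
open import Data.List using (List; []; _∷_; allFin)
open import Data.List.Membership.Propositional using (_∈_)
open import Data.List.Membership.Propositional.Properties using (∈-allFin)
open import Data.List.Relation.Unary.Any using (here; there)
open import Data.Nat using (NonZero; z≤n; s≤s; _∸_; _/_; _%_; _≤ᵇ_; _<ᵇ_; _≟_; _≤?_; _<?_)
open import Data.Nat.DivMod using (m≡m%n+[m/n]*n; m%n<n; m/n*n≤m; m*n/n≡m; /-monoˡ-≤; +-distrib-/-∣ʳ)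
open import Data.Nat.Divisibility using (n∣m*n)
open import Data.Nat.Logarithm using (⌈log₂⌉-mono-≤)
open import Data.Nat.Properties hiding (_≟_; _≤?_; _<?_)
open import Data.Nat.Tactic.RingSolver using (solve-∀)
open import Data.Product using (proj₁; proj₂)
open import Data.Sum using (_⊎_; inj₁; inj₂; [_,_]′; map; swap)
open import Function using (_∘_; id)
open import Function.Bundles using (Equivalence)
open import Relation.Binary.Construct.Closure.ReflexiveTransitive
  using (Star; ε; _◅_; _◅◅_; reverse; gmap; return)
open import Relation.Binary.PropositionalEquality
open import Relation.Nullary using (¬_; Dec; yes; no; does; contradiction)
open import Relation.Nullary.Decidable using (map′; _×-dec_; _⊎-dec_; ¬?; dec-true)

-- Take the first stage with a red component holding a third of a window of
-- consecutive leaves, and let W be the union of some of the previous components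
-- inside it, chosen greedily so that W holds between a third and two thirds of
-- the window.  Leaves of W with different neighbourhoods outside W lie in
-- different parts, and all of these parts lie in the new component, so it
-- suffices to find about h / 7 leaves of W with distinct outside neighbourhoods.
--
-- Sliding windows yield nested balanced windows at every scale, hence a point b
-- near which both W and its complement are present at every scale.  At scale 3^κ
-- some edge x y leaves W, lies within distance O(3^κ) of b, and has an endpoint
-- at distance between 4·3^k and 6·3^k from everything closer to b, hence
-- nonadjacent to all the edges found at smaller scales.  The endpoints in W of
-- these edges are therefore separated from each other by the endpoints outside W.

-- Counting points in windows of consecutive integers

bit : Bool → ℕ
bit false = 0
bit true  = 1

bit≤1 : ∀ β → bit β ≤ 1
bit≤1 false = z≤n
bit≤1 true  = ≤-refl

count : (ℕ → Bool) → ℕ → ℕ → ℕ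
count f s zero    = 0
count f s (suc L) = bit (f s) + count f (suc s) L

count-++ : ∀ f s L M → count f s (L + M) ≡ count f s L + count f (s + L) M
count-++ f s zero    M = cong (λ r → count f r M) (sym (+-identityʳ s))
count-++ f s (suc L) M = begin
  bit (f s) + count f (suc s) (L + M)                           ≡⟨ cong (bit (f s) +_) (count-++ f (suc s) L M) ⟩
  bit (f s) + (count f (suc s) L + count f (suc s + L) M)       ≡⟨ sym (+-assoc (bit (f s)) _ _) ⟩
  count f s (suc L) + count f (suc s + L) M                     ≡⟨ cong (λ r → count f s (suc L) + count f r M) (sym (+-suc s L)) ⟩
  count f s (suc L) + count f (s + suc L) M                     ∎
  where open ≡-Reasoning

-- Both sides count the window of length `L + 1`, split at its left or its right end. Hence a shift
-- by one changes a count by at most one.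
count-slide : ∀ f s L → bit (f s) + count f (suc s) L ≡ count f s L + bit (f (s + L))
count-slide f s L = begin
  count f s (suc L)                        ≡⟨ cong (count f s) (sym (+-comm L 1)) ⟩
  count f s (L + 1)                        ≡⟨ count-++ f s L 1 ⟩
  count f s L + (bit (f (s + L)) + 0)      ≡⟨ cong (count f s L +_) (+-identityʳ _) ⟩
  count f s L + bit (f (s + L))            ∎
  where open ≡-Reasoning

count-suc≤ : ∀ f s L → count f (suc s) L ≤ suc (count f s L)
count-suc≤ f s L = begin
  count f (suc s) L                  ≤⟨ m≤n+m _ (bit (f s)) ⟩
  bit (f s) + count f (suc s) L      ≡⟨ count-slide f s L ⟩
  count f s L + bit (f (s + L))      ≤⟨ +-monoʳ-≤ _ (bit≤1 _) ⟩
  count f s L + 1                    ≡⟨ +-comm _ 1 ⟩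
  suc (count f s L)                  ∎
  where open ≤-Reasoning

count-≤suc : ∀ f s L → count f s L ≤ suc (count f (suc s) L)
count-≤suc f s L = begin
  count f s L                        ≤⟨ m≤m+n _ _ ⟩
  count f s L + bit (f (s + L))      ≡⟨ sym (count-slide f s L) ⟩
  bit (f s) + count f (suc s) L      ≤⟨ +-monoˡ-≤ _ (bit≤1 _) ⟩
  suc (count f (suc s) L)            ∎
  where open ≤-Reasoning

count-true : ∀ s L → count (λ _ → true) s L ≡ L
count-true s zero    = refl
count-true s (suc L) = cong suc (count-true (suc s) L)

bit-not : ∀ β → bit β + bit (not β) ≡ 1
bit-not false = refl
bit-not true  = refl

count-not : ∀ f s L → count f s L + count (not ∘ f) s L ≡ L
count-not f s zero    = refl
count-not f s (suc L) = begin
  (bit (f s) + count f (suc s) L) + (bit (not (f s)) + count (not ∘ f) (suc s) L)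
    ≡⟨ interchange +-commutativeSemigroup (bit (f s)) _ _ _ ⟩
  (bit (f s) + bit (not (f s))) + (count f (suc s) L + count (not ∘ f) (suc s) L)
    ≡⟨ cong₂ _+_ (bit-not (f s)) (count-not f (suc s) L) ⟩
  suc L ∎
  where open ≡-Reasoning

bit-≤-∨ : ∀ α β γ → (α ≡ true → β ≡ true ⊎ γ ≡ true) → bit α ≤ bit β + bit γ
bit-≤-∨ false β     γ     _ = z≤n
bit-≤-∨ true  true  γ     _ = s≤s z≤n
bit-≤-∨ true  false true  _ = ≤-refl
bit-≤-∨ true  false false c with c refl
... | inj₁ ()
... | inj₂ ()

count-⊆-∪ : ∀ f g h s L → (∀ x → f x ≡ true → g x ≡ true ⊎ h x ≡ true) →
            count f s L ≤ count g s L + count h s L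
count-⊆-∪ f g h s zero    c = z≤n
count-⊆-∪ f g h s (suc L) c = begin
  bit (f s) + count f (suc s) L
    ≤⟨ +-mono-≤ (bit-≤-∨ _ _ _ (c s)) (count-⊆-∪ f g h (suc s) L c) ⟩
  (bit (g s) + bit (h s)) + (count g (suc s) L + count h (suc s) L)
    ≡⟨ interchange +-commutativeSemigroup (bit (g s)) _ _ _ ⟩
  (bit (g s) + count g (suc s) L) + (bit (h s) + count h (suc s) L) ∎
  where open ≤-Reasoning

-- Pigeonhole: every comparison of counts is turned into a witness through this lemma.
count-excess : ∀ f g s L → count g s L < count f s L →
               ∃[ x ] (s ≤ x × x < s + L × f x ≡ true × g x ≡ false)
count-excess f g s (suc L) lt with f s in fs | g s in gs
... | true | false = s , ≤-refl , m<m+n s (s≤s z≤n) , fs , gs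
... | true | true with count-excess f g (suc s) L (≤-pred lt)
...   | x , lo , hi , fx , gx = x , <⇒≤ lo , subst (x <_) (sym (+-suc s L)) hi , fx , gx
count-excess f g s (suc L) lt | false | β
  with count-excess f g (suc s) L (≤-<-trans (m≤n+m _ (bit β)) lt)
... | x , lo , hi , fx , gx = x , <⇒≤ lo , subst (x <_) (sym (+-suc s L)) hi , fx , gx

between : ℕ → ℕ → ℕ → Bool
between u v x = (u ≤ᵇ x) ∧ (x <ᵇ v)

between-true : ∀ u v x → u ≤ x → x < v → between u v x ≡ true
between-true u v x u≤x x<v with u ≤ᵇ x | ≤⇒≤ᵇ u≤x | x <ᵇ v | <⇒<ᵇ x<v
... | true | _ | true | _ = refl

between-⇒ : ∀ u v x → between u v x ≡ true → u ≤ x × x < v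
between-⇒ u v x e with u ≤ᵇ x in p | x <ᵇ v in q
... | true | true = ≤ᵇ⇒≤ u x (subst T (sym p) _) , <ᵇ⇒< x v (subst T (sym q) _)

between-false : ∀ u v x → between u v x ≡ false → x < u ⊎ v ≤ x
between-false u v x e with x <? u | v ≤? x
... | yes p | _     = inj₁ p
... | no _  | yes p = inj₂ p
... | no p  | no q with trans (sym (between-true u v x (≮⇒≥ p) (≰⇒> q))) e
...   | ()

count-between-≤∸ : ∀ u v s L → count (between u v) s L ≤ v ∸ s
count-between-≤∸ u v s zero    = z≤n
count-between-≤∸ u v s (suc L) with between u v s in eq
... | false = ≤-trans (count-between-≤∸ u v (suc s) L) (∸-monoʳ-≤ v (n≤1+n s))
... | true  = ≤-trans (s≤s (count-between-≤∸ u v (suc s) L))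
                      (≤-reflexive (sym (+-∸-assoc 1 (proj₂ (between-⇒ u v s eq)))))

count-between : ∀ u v s L → count (between u v) s L ≤ v ∸ u
count-between u v s zero    = z≤n
count-between u v s (suc L) with u ≤? s
... | yes u≤s = ≤-trans (count-between-≤∸ u v s (suc L)) (∸-monoʳ-≤ v u≤s)
... | no u≰s with between u v s in eq
...   | true  = contradiction (proj₁ (between-⇒ u v s eq)) u≰s
...   | false = count-between u v (suc s) L

-- Balanced windows by a discrete intermediate value argument

module Slide (f : ℕ → Bool) (L lo hi : ℕ) (lo≤hi : lo ≤ hi) where

  Balanced : ℕ → Set
  Balanced s = lo ≤ count f s L × count f s L ≤ hi

  data Position (s : ℕ) : Set where
    low  : count f s L < lo → Position s
    bal  : Balanced s → Position s
    high : hi < count f s L → Position s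

  position : ∀ s → Position s
  position s with lo ≤? count f s L | count f s L ≤? hi
  ... | no p  | _     = low (≰⇒> p)
  ... | yes p | yes q = bal (p , q)
  ... | yes _ | no q  = high (≰⇒> q)

  -- A count below `lo` grows by at most one per shift, so by `lo ≤ hi` it cannot jump over the
  -- interval from `lo` to `hi`.
  slide-up : ∀ s d → count f s L < lo → hi < count f (d + s) L →
             ∃[ r ] (s ≤ r × r ≤ d + s × Balanced r)
  slide-up s zero    l h = contradiction (<-≤-trans l lo≤hi) (<⇒≯ h)
  slide-up s (suc d) l h with position (suc s)
  ... | bal b  = suc s , n≤1+n s , s≤s (m≤n+m s d) , b
  ... | high h′ = contradiction (≤-trans (count-suc≤ f s L) (≤-trans l lo≤hi)) (<⇒≱ h′)
  ... | low l′ with slide-up (suc s) d l′ (subst (λ r → hi < count f r L) (sym (+-suc d s)) h)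
  ...   | r , a , c , b = r , <⇒≤ a , subst (r ≤_) (+-suc d s) c , b

  slide-down : ∀ s d → hi < count f s L → count f (d + s) L < lo →
               ∃[ r ] (s ≤ r × r ≤ d + s × Balanced r)
  slide-down s zero    h l = contradiction (<-≤-trans l lo≤hi) (<⇒≯ h)
  slide-down s (suc d) h l with position (suc s)
  ... | bal b  = suc s , n≤1+n s , s≤s (m≤n+m s d) , b
  ... | low l′ = contradiction (≤-trans (s≤s lo≤hi) (≤-trans h (count-≤suc f s L))) (<⇒≱ (s≤s l′))
  ... | high h′ with slide-down (suc s) d h′ (subst (λ r → count f r L < lo) (sym (+-suc d s)) l)
  ...   | r , a , c , b = r , <⇒≤ a , subst (r ≤_) (+-suc d s) c , b

  -- The first field of `all-low` and `all-high` keeps the state of the leftmost window: a window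
  -- prepended on the left either agrees with it or leaves room for sliding between the two.
  data Outcome (s D : ℕ) : Set where
    found    : ∀ r → s ≤ r → r + L ≤ s + D * L → Balanced r → Outcome s D
    all-low  : count f s L < lo → count f s (D * L) < D * lo → Outcome s D
    all-high : hi < count f s L → D * hi < count f s (D * L) → Outcome s D

  second-window : ∀ D {s r} → r ≤ L + s → r + L ≤ s + (L + (L + D * L))
  second-window D {s} c = ≤-trans (+-monoˡ-≤ L (≤-trans c (≤-reflexive (+-comm L s))))
    (≤-trans (≤-reflexive (+-assoc s L L)) (+-monoʳ-≤ s (+-monoʳ-≤ L (m≤m+n L _))))

  scan : ∀ D s → Outcome s (suc D)
  scan zero s with position s
  ... | bal b  = found s ≤-refl (≤-reflexive (cong (s +_) (sym (+-identityʳ L)))) b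
  ... | low l  = all-low l (subst₂ (λ a b → count f s a < b) (sym (+-identityʳ L)) (sym (+-identityʳ lo)) l)
  ... | high h = all-high h (subst₂ (λ a b → b < count f s a) (sym (+-identityʳ L)) (sym (+-identityʳ hi)) h)
  scan (suc D) s with position s | scan D (s + L)
  ... | bal b  | _ = found s ≤-refl (+-monoʳ-≤ s (m≤m+n L _)) b
  ... | _      | found r a c b =
    found r (≤-trans (m≤m+n s L) a) (≤-trans c (≤-reflexive (+-assoc s L _))) b
  ... | low l  | all-low _ c =
    all-low l (subst (_< lo + suc D * lo) (sym (count-++ f s L (suc D * L))) (+-mono-< l c))
  ... | high h | all-high _ c =
    all-high h (subst (hi + suc D * hi <_) (sym (count-++ f s L (suc D * L))) (+-mono-< h c))
  ... | low l  | all-high h _ with slide-up s L l (subst (λ r → hi < count f r L) (+-comm s L) h)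
  ...   | r , a , c , b = found r a (second-window D c) b
  scan (suc D) s | high h | all-low l _ with slide-down s L h (subst (λ r → count f r L < lo) (+-comm s L) l)
  ...   | r , a , c , b = found r a (second-window D c) b

  -- If no balanced window exists, all the aligned ones are unbalanced in the same
  -- direction, because counts of adjacent windows differ by at most one.
  balanced-subwindow : ∀ D s → suc D * lo ≤ count f s (suc D * L) → count f s (suc D * L) ≤ suc D * hi →
                       ∃[ r ] (s ≤ r × r + L ≤ s + suc D * L × Balanced r)
  balanced-subwindow D s l h with scan D s
  ... | found r a c b  = r , a , c , b
  ... | all-low _ c  = contradiction l (<⇒≱ c)
  ... | all-high _ c = contradiction h (<⇒≱ c)

subwindow : ∀ f s d .{{_ : NonZero d}} g {a c} w → a ≤ c →
            a * (d * g) ≤ count f s (w * (d * g)) → count f s (w * (d * g)) ≤ c * (d * g) →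
            ∃[ r ] (s ≤ r × r + w * g ≤ s + w * (d * g) × a * g ≤ count f r (w * g) × count f r (w * g) ≤ c * g)
subwindow f s d@(suc D) g {a} {c} w a≤c l u
  -- With `d` moved to the front, the large window reads as `d` consecutive windows of length
  -- `w * g`, with the same density bounds.
  rewrite x∙yz≈y∙xz *-commutativeSemigroup a d g
        | x∙yz≈y∙xz *-commutativeSemigroup c d g
        | x∙yz≈y∙xz *-commutativeSemigroup w d g =
  Slide.balanced-subwindow f (w * g) (a * g) (c * g) (*-monoˡ-≤ g a≤c) D s l u

-- Adjacency of leaves

Adjacent : ℕ → ℕ → ℕ → Set
Adjacent h x y = ∃[ l ] (l ≤ h × Dist3 (anc l x) (anc l y))

Adjacent-sym : ∀ {h x y} → Adjacent h x y → Adjacent h y x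
Adjacent-sym (l , l≤h , d) = l , l≤h , swap d

m<suc[m/n]*n : ∀ m n .{{_ : NonZero n}} → m < suc (m / n) * n
m<suc[m/n]*n m n = begin-strict
  m                    ≡⟨ m≡m%n+[m/n]*n m n ⟩
  m % n + m / n * n    <⟨ +-monoˡ-< (m / n * n) (m%n<n m n) ⟩
  n + m / n * n        ∎
  where open ≤-Reasoning

-- Together with `anc-<*` this pins `anc l x` down as the floor of `x / 3 ^ l`.
anc-* : ∀ l x → anc l x * 3 ^ l ≤ x
anc-* zero    x = ≤-reflexive (*-identityʳ x)
anc-* (suc l) x = begin
  anc l x / 3 * (3 * 3 ^ l)  ≡⟨ sym (*-assoc (anc l x / 3) 3 (3 ^ l)) ⟩
  anc l x / 3 * 3 * 3 ^ l    ≤⟨ *-monoˡ-≤ (3 ^ l) (m/n*n≤m (anc l x) 3) ⟩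
  anc l x * 3 ^ l            ≤⟨ anc-* l x ⟩
  x                          ∎
  where open ≤-Reasoning

anc-<* : ∀ l x → x < suc (anc l x) * 3 ^ l
anc-<* zero    x = ≤-reflexive (sym (*-identityʳ (suc x)))
anc-<* (suc l) x = begin-strict
  x                                <⟨ anc-<* l x ⟩
  suc (anc l x) * 3 ^ l            ≤⟨ *-monoˡ-≤ (3 ^ l) (m<suc[m/n]*n (anc l x) 3) ⟩
  suc (anc l x / 3) * 3 * 3 ^ l    ≡⟨ *-assoc (suc (anc l x / 3)) 3 (3 ^ l) ⟩
  suc (anc l x / 3) * (3 * 3 ^ l)  ∎
  where open ≤-Reasoning

anc-mono : ∀ l {x y} → x ≤ y → anc l x ≤ anc l y
anc-mono zero    x≤y = x≤y
anc-mono (suc l) x≤y = /-monoˡ-≤ 3 (anc-mono l x≤y)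

[m+q*3]/3 : ∀ m q → (m + q * 3) / 3 ≡ m / 3 + q
[m+q*3]/3 m q = trans (+-distrib-/-∣ʳ m (n∣m*n q)) (cong (m / 3 +_) (m*n/n≡m q 3))

anc-shift : ∀ l x j → anc l (x + j * 3 ^ l) ≡ anc l x + j
anc-shift zero    x j = cong (x +_) (*-identityʳ j)
anc-shift (suc l) x j = begin
  anc l (x + j * (3 * 3 ^ l)) / 3   ≡⟨ cong (λ i → anc l (x + i) / 3) (sym (*-assoc j 3 (3 ^ l))) ⟩
  anc l (x + j * 3 * 3 ^ l) / 3     ≡⟨ cong (_/ 3) (anc-shift l x (j * 3)) ⟩
  (anc l x + j * 3) / 3             ≡⟨ [m+q*3]/3 (anc l x) j ⟩
  anc l x / 3 + j                   ∎
  where open ≡-Reasoning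

adjacent-shift : ∀ {h} l x → l ≤ h → Adjacent h x (x + 3 * 3 ^ l)
adjacent-shift l x l≤h = l , l≤h , inj₂ (anc-shift l x 3)

anc-gap : ∀ l x y → anc l x ≡ anc l y + 3 → x < y + 4 * 3 ^ l × y + 2 * 3 ^ l < x
anc-gap l x y e = upper , lower
  where
  open ≤-Reasoning
  q = 3 ^ l
  rearrange₁ : ∀ a q → suc (a + 3) * q ≡ a * q + 4 * q
  rearrange₁ = solve-∀
  rearrange₂ : ∀ a q → suc a * q + 2 * q ≡ (a + 3) * q
  rearrange₂ = solve-∀
  upper : x < y + 4 * q
  upper = begin-strict
    x                        <⟨ anc-<* l x ⟩
    suc (anc l x) * q        ≡⟨ cong (λ a → suc a * q) e ⟩
    suc (anc l y + 3) * q    ≡⟨ rearrange₁ (anc l y) q ⟩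
    anc l y * q + 4 * q      ≤⟨ +-monoˡ-≤ _ (anc-* l y) ⟩
    y + 4 * q                ∎
  lower : y + 2 * q < x
  lower = begin-strict
    y + 2 * q                    <⟨ +-monoˡ-< _ (anc-<* l y) ⟩
    suc (anc l y) * q + 2 * q    ≡⟨ rearrange₂ (anc l y) q ⟩
    (anc l y + 3) * q            ≡⟨ cong (_* q) (sym e) ⟩
    anc l x * q                  ≤⟨ anc-* l x ⟩
    x                            ∎

-- By `anc-gap`, a link at level `l` spans more than `2 * 3 ^ l` and less than `4 * 3 ^ l`. Levels
-- up to `k` are therefore too short for the distance, and levels from `k + 1` on too long, as
-- `2 * 3 ^ (k + 1)` is `6 * 3 ^ k`.
far-nonadjacent : ∀ {h} k x y → y + 4 * 3 ^ k ≤ x → x ≤ y + 6 * 3 ^ k → ¬ Adjacent h x y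
far-nonadjacent k x y lo hi (l , _ , inj₂ e) =
  contradiction (anc-mono l (≤-trans (m≤m+n y _) lo))
    (<⇒≱ (subst (anc l x <_) (sym e) (m<m+n (anc l x) (s≤s z≤n))))
far-nonadjacent k x y lo hi (l , _ , inj₁ e) with anc-gap l x y e | l ≤? k
... | u , _ | yes l≤k =
  <⇒≱ u (≤-trans (+-monoʳ-≤ y (*-monoʳ-≤ 4 (^-monoʳ-≤ 3 l≤k))) lo)
... | _ , v | no l≰k =
  <⇒≱ v (≤-trans hi (+-monoʳ-≤ y (begin
    6 * 3 ^ k           ≡⟨ *-assoc 2 3 (3 ^ k) ⟩
    2 * 3 ^ suc k       ≤⟨ *-monoʳ-≤ 2 (^-monoʳ-≤ 3 (≰⇒> l≰k)) ⟩
    2 * 3 ^ l           ∎)))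
  where open ≤-Reasoning

-- Boolean tests, paths across a cut, and distance

≤-eval : ∀ {m n} {m≤n : T (m ≤ᵇ n)} → m ≤ n
≤-eval {m} {n} {m≤n} = ≤ᵇ⇒≤ m n m≤n

∨-falseˡ : ∀ α β → α ∨ β ≡ false → α ≡ false
∨-falseˡ false β e = refl

∨-falseʳ : ∀ α β → α ∨ β ≡ false → β ≡ false
∨-falseʳ false β e = e

∨-true : ∀ α β → α ∨ β ≡ true → α ≡ true ⊎ β ≡ true
∨-true true  β e = inj₁ refl
∨-true false β e = inj₂ e

crossing : ∀ {E : ℕ → ℕ → Set} (χ : ℕ → Bool) {p q} → Star E p q → χ p ≡ true → χ q ≡ false →
           ∃[ x ] ∃[ y ] (E x y × χ x ≡ true × χ y ≡ false)
crossing χ ε χp χq with trans (sym χp) χq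
... | ()
crossing χ {p} (_◅_ {j = r} e es) χp χq with χ r in χr
... | true  = crossing χ es χr χq
... | false = p , r , e , χp , χr

Near : ℕ → ℕ → ℕ → Set
Near b r z = b ≤ z + r × z ≤ b + r

Near-≤ : ∀ {b r r′ z} → r ≤ r′ → Near b r z → Near b r′ z
Near-≤ r≤r′ (l , u) = ≤-trans l (+-monoʳ-≤ _ r≤r′) , ≤-trans u (+-monoʳ-≤ _ r≤r′)

-- Paths at one scale

-- Positions are measured from o in units of g = 3^κ.  The point b is at 486, so that
-- everything found at smaller scales lies in [485, 487].
module Scale (h κ g o : ℕ) (3^κ≡g : 3 ^ κ ≡ g) (κ+5≤h : 5 + κ ≤ h) where

  instance
    g-nonZero : NonZero g
    g-nonZero = subst NonZero 3^κ≡g (m^n≢0 3 κ)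

  record In (a c x : ℕ) : Set where
    constructor _,_
    field
      lower : o + a * g ≤ x
      upper : x ≤ o + c * g
  open In public

  In-⊆ : ∀ {a a′ c c′ x} → a′ ≤ a → c ≤ c′ → In a c x → In a′ c′ x
  In-⊆ a′≤a c≤c′ (l , u) =
    ≤-trans (+-monoʳ-≤ o (*-monoˡ-≤ g a′≤a)) l , ≤-trans u (+-monoʳ-≤ o (*-monoˡ-≤ g c≤c′))

  split-offset : ∀ o a g j → o + (a + j) * g ≡ o + a * g + j * g
  split-offset = solve-∀

  In-shift : ∀ {a c x} j → In a c x → In (a + j) (c + j) (x + j * g)
  In-shift {a} {c} {x} j (l , u) =
    ≤-trans (≤-reflexive (split-offset o a g j)) (+-monoˡ-≤ (j * g) l) ,
    ≤-trans (+-monoˡ-≤ (j * g) u) (≤-reflexive (sym (split-offset o c g j)))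

  In-unshift : ∀ {a c x} j → In (a + j) (c + j) (x + j * g) → In a c x
  In-unshift {a} {c} {x} j (l , u) =
    +-cancelʳ-≤ (j * g) _ _ (≤-trans (≤-reflexive (sym (split-offset o a g j))) l) ,
    +-cancelʳ-≤ (j * g) _ _ (≤-trans u (≤-reflexive (split-offset o c g j)))

  In-+ : ∀ {a c x} i → i ≤ 10 → In a c x → In a (c + 10) (x + i)
  In-+ {a} {c} {x} i i≤10 (l , u) =
    ≤-trans l (m≤m+n x i) ,
    ≤-trans (+-mono-≤ u (≤-trans i≤10 (m≤m*n 10 g)))
            (≤-reflexive (sym (split-offset o c g 10)))

  Clean : ℕ → Set
  Clean x = ∀ y → In 485 487 y → ¬ Adjacent h x y

  3^[j+κ] : ∀ j → 3 ^ (j + κ) ≡ 3 ^ j * g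
  3^[j+κ] j = trans (^-distribˡ-+-* 3 j κ) (cong (3 ^ j *_) 3^κ≡g)

  add-offset : ∀ o c n w g → o + c * g + n * (w * g) ≡ o + (n * w + c) * g
  add-offset = solve-∀

  below : ∀ {n a c x y} j → n * 3 ^ j + c ≤ a → y ≤ o + c * g → o + a * g ≤ x → y + n * 3 ^ (j + κ) ≤ x
  below {n} {a} {c} {x} {y} j le u l = begin
    y + n * 3 ^ (j + κ)              ≤⟨ +-monoˡ-≤ _ u ⟩
    o + c * g + n * 3 ^ (j + κ)      ≡⟨ cong (λ i → o + c * g + n * i) (3^[j+κ] j) ⟩
    o + c * g + n * (3 ^ j * g)      ≡⟨ add-offset o c n (3 ^ j) g ⟩
    o + (n * 3 ^ j + c) * g          ≤⟨ +-monoʳ-≤ o (*-monoˡ-≤ g le) ⟩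
    o + a * g                        ≤⟨ l ⟩
    x                                ∎
    where open ≤-Reasoning

  above : ∀ {n a c x y} j → c ≤ n * 3 ^ j + a → x ≤ o + c * g → o + a * g ≤ y → x ≤ y + n * 3 ^ (j + κ)
  above {n} {a} {c} {x} {y} j le u l = begin
    x                                ≤⟨ u ⟩
    o + c * g                        ≤⟨ +-monoʳ-≤ o (*-monoˡ-≤ g le) ⟩
    o + (n * 3 ^ j + a) * g          ≡⟨ sym (add-offset o a n (3 ^ j) g) ⟩
    o + a * g + n * (3 ^ j * g)      ≡⟨ cong (λ i → o + a * g + n * i) (sym (3^[j+κ] j)) ⟩
    o + a * g + n * 3 ^ (j + κ)      ≤⟨ +-monoˡ-≤ _ l ⟩
    y + n * 3 ^ (j + κ)              ∎
    where open ≤-Reasoning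

  -- The distances from the interval `[a, c]` to `[485, 487]` range from `a - 487` to `c - 485`
  -- units; the hypotheses place them in the forbidden zone of `far-nonadjacent` at level `j + κ`.
  clean-right : ∀ {a c x} j → 4 * 3 ^ j + 487 ≤ a → c ≤ 6 * 3 ^ j + 485 → In a c x → Clean x
  clean-right j le₁ le₂ (l , u) y (l′ , u′) =
    far-nonadjacent (j + κ) _ y (below {4} j le₁ u′ l) (above {6} j le₂ u l′)

  clean-left : ∀ {a c x} j → 4 * 3 ^ j + c ≤ 485 → 487 ≤ 6 * 3 ^ j + a → In a c x → Clean x
  clean-left j le₁ le₂ (l , u) y (l′ , u′) =
    far-nonadjacent (j + κ) y _ (below {4} j le₁ u l′) (above {6} j le₂ u′ l) ∘ Adjacent-sym {h}

  -- One clean endpoint suffices, on either side of the cut, to tell the new edge apart from all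
  -- edges near `b`. The range `[0, 1684]` bounds the distance to `b`.
  record Edge (x y : ℕ) : Set where
    constructor edge
    field
      adjacent : Adjacent h x y
      nearˡ    : In 0 1684 x
      nearʳ    : In 0 1684 y
      clean    : Clean x ⊎ Clean y

  Edge-sym : ∀ {x y} → Edge x y → Edge y x
  Edge-sym (edge a n n′ c) = edge (Adjacent-sym {h} a) n′ n (swap c)

  Path : ℕ → ℕ → Set
  Path = Star Edge

  path-sym : ∀ {x y} → Path x y → Path y x
  path-sym = reverse Edge-sym

  -- A shift by `3 ^ suc j` units is a shift by three nodes at level `j + κ`, so it always yields a
  -- neighbour.
  shift : ∀ j {s} x → 3 ^ suc j ≡ s → j ≤ 5 → Adjacent h x (x + s * g)
  shift j x refl j≤5 = subst (λ i → Adjacent h x (x + i))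
    (trans (cong (3 *_) (3^[j+κ] j)) (sym (*-assoc 3 (3 ^ j) g)))
    (adjacent-shift (j + κ) x (≤-trans (+-monoˡ-≤ κ j≤5) κ+5≤h))

  near : ∀ {a c x} → {c≤ : T (c ≤ᵇ 1684)} → In a c x → In 0 1684 x
  near {c≤ = c≤} = In-⊆ z≤n (≤ᵇ⇒≤ _ _ c≤)

  -- Every point of the window outside the gaps below is joined to this interval of
  -- clean points by edges with a clean endpoint.
  Hub : ℕ → Set
  Hub = In 1485 1674

  hub-edge : ∀ {x y} → In 1485 1684 x → In 1485 1684 y → Adjacent h x y → Edge x y
  hub-edge x∈ y∈ a = edge a (near x∈) (near y∈) (inj₁ (clean-right 5 ≤-eval ≤-eval x∈))

  1≤h : 1 ≤ h
  1≤h = ≤-trans (s≤s z≤n) κ+5≤h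

  adjacent₀ : ∀ x → Adjacent h x (3 + x)
  adjacent₀ x = 0 , z≤n , inj₂ (+-comm 3 x)

  adjacent₁ : ∀ r r′ q → r′ / 3 ≡ 3 + r / 3 → Adjacent h (r + q * 3) (r′ + q * 3)
  adjacent₁ r r′ q e = 1 , 1≤h , inj₂ (begin
    (r′ + q * 3) / 3        ≡⟨ [m+q*3]/3 r′ q ⟩
    r′ / 3 + q              ≡⟨ cong (_+ q) e ⟩
    3 + r / 3 + q           ≡⟨ +-comm 3 (r / 3 + q) ⟩
    r / 3 + q + 3           ≡⟨ cong (_+ 3) (sym ([m+q*3]/3 r q)) ⟩
    (r + q * 3) / 3 + 3     ∎)
    where open ≡-Reasoning

  -- The hub ends 10 units before 1684, so that detours of at most 10 leaves beyond it stay in the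
  -- clean range.
  hub-wide : ∀ {z} i → i ≤ 10 → Hub z → In 1485 1684 (i + z)
  hub-wide {z} i i≤10 z∈ = subst (In 1485 1684) (+-comm z i) (In-+ i i≤10 z∈)

  -- Leaves with the same parent have a common neighbour three parents to the right. Across a
  -- boundary between parents, two such neighbours at distance 3 are used, which are adjacent at
  -- level 0.
  hub-suc-mod : ∀ r q → r < 3 → Hub (r + q * 3) → Hub (suc (r + q * 3)) → Path (r + q * 3) (suc (r + q * 3))
  hub-suc-mod 0 q _ z∈ z′∈ =
    hub-edge (hub-wide 0 ≤-eval z∈) (hub-wide 9 ≤-eval z∈) (adjacent₁ 0 9 q refl) ◅
    Edge-sym (hub-edge (hub-wide 0 ≤-eval z′∈) (hub-wide 9 ≤-eval z∈) (adjacent₁ 1 9 q refl)) ◅ ε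
  hub-suc-mod 1 q _ z∈ z′∈ =
    hub-edge (hub-wide 0 ≤-eval z∈) (hub-wide 9 ≤-eval z∈) (adjacent₁ 1 10 q refl) ◅
    Edge-sym (hub-edge (hub-wide 0 ≤-eval z′∈) (hub-wide 9 ≤-eval z∈) (adjacent₁ 2 10 q refl)) ◅ ε
  hub-suc-mod 2 q _ z∈ z′∈ =
    hub-edge (hub-wide 0 ≤-eval z∈) (hub-wide 7 ≤-eval z∈) (adjacent₁ 2 9 q refl) ◅
    hub-edge (hub-wide 7 ≤-eval z∈) (hub-wide 10 ≤-eval z∈) (adjacent₀ (9 + q * 3)) ◅
    Edge-sym (hub-edge (hub-wide 0 ≤-eval z′∈) (hub-wide 10 ≤-eval z∈) (adjacent₁ 3 12 q refl)) ◅ ε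
  hub-suc-mod (suc (suc (suc _))) q (s≤s (s≤s (s≤s ())))

  hub-suc : ∀ z → Hub z → Hub (suc z) → Path z (suc z)
  hub-suc z = subst (λ x → Hub x → Hub (suc x) → Path x (suc x))
    (sym (m≡m%n+[m/n]*n z 3)) (hub-suc-mod (z % 3) (z / 3) (m%n<n z 3))

  hub-+ : ∀ d z → Hub z → Hub (d + z) → Path z (d + z)
  hub-+ zero    z z∈ z′∈ = ε
  hub-+ (suc d) z z∈ z′∈ = hub-+ d z z∈ m∈ ◅◅ hub-suc (d + z) m∈ z′∈
    where
    m∈ : Hub (d + z)
    m∈ = ≤-trans (lower z∈) (m≤n+m z d) , ≤-trans (n≤1+n _) (upper {1485} {1674} z′∈)

  hub-path : ∀ z z′ → Hub z → Hub z′ → Path z z′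
  hub-path z z′ z∈ z′∈ with ≤-total z z′
  ... | inj₁ z≤z′ = subst (Path z) (m∸n+n≡m z≤z′)
          (hub-+ (z′ ∸ z) z z∈ (subst Hub (sym (m∸n+n≡m z≤z′)) z′∈))
  ... | inj₂ z′≤z = path-sym (subst (Path z′) (m∸n+n≡m z′≤z)
          (hub-+ (z ∸ z′) z′ z′∈ (subst Hub (sym (m∸n+n≡m z′≤z)) z∈)))

  ToHub : ℕ → Set
  ToHub p = ∃[ z ] (Hub z × Path p z)

  _◅ʰ_ : ∀ {p q} → Edge p q → ToHub q → ToHub p
  e ◅ʰ (z , z∈ , es) = z , z∈ , e ◅ es

  at-hub : ∀ {a c x} → {1485≤a : T (1485 ≤ᵇ a)} → {c≤1674 : T (c ≤ᵇ 1674)} → In a c x → ToHub x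
  at-hub {1485≤a = l} {u} x∈ = _ , In-⊆ (≤ᵇ⇒≤ _ _ l) (≤ᵇ⇒≤ _ _ u) x∈ , ε

  -- Shifts by 243 and 729 lead through `[811, 945]` to `[1540, 1674]`; 568 is the least start for
  -- which the first stop is clean, and 702 is the right end of the possible windows around `b`.
  far-right-to-hub : ∀ {p} → In 568 702 p → ToHub p
  far-right-to-hub {p} p∈ =
    edge (shift 4 p refl ≤-eval) (near p∈) (near p₁∈) (inj₂ (clean-right 4 ≤-eval ≤-eval p₁∈)) ◅ʰ
    (edge (shift 5 _ refl ≤-eval) (near p₁∈) (near p₂∈) (inj₂ (clean-right 5 ≤-eval ≤-eval p₂∈)) ◅ʰ
    at-hub p₂∈)
    where
    p₁∈ = In-shift 243 p∈
    p₂∈ = In-shift 729 p₁∈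

  near-right-to-hub : ∀ {p} → In 514 566 p → ToHub p
  near-right-to-hub {p} p∈ =
    edge (shift 3 p refl ≤-eval) (near p∈) (near p₁∈) (inj₂ (clean-right 3 ≤-eval ≤-eval p₁∈)) ◅ʰ
    (edge (shift 4 _ refl ≤-eval) (near p₁∈) (near p₂∈) (inj₂ (clean-right 4 ≤-eval ≤-eval p₂∈)) ◅ʰ
    (edge (shift 5 _ refl ≤-eval) (near p₂∈) (near p₃∈) (inj₂ (clean-right 5 ≤-eval ≤-eval p₃∈)) ◅ʰ
    at-hub p₃∈))
    where
    p₁∈ = In-shift 81 p∈
    p₂∈ = In-shift 243 p₁∈
    p₃∈ = In-shift 729 p₂∈

  -- Points left of `b` first step further left, to a clean `p`. Since `p` is clean, it may then
  -- jump over `b` by 729, whatever the landing point.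
  far-left-to-hub : ∀ {p} → In 27 161 p → ToHub (p + 243 * g)
  far-left-to-hub {p} p∈ =
    Edge-sym (edge (shift 4 p refl ≤-eval) (near p∈) (near (In-shift 243 p∈)) (inj₁ clean)) ◅ʰ
    (edge (shift 5 p refl ≤-eval) (near p∈) (near p₁∈) (inj₁ clean) ◅ʰ
    (edge (shift 5 _ refl ≤-eval) (near p₁∈) (near p₂∈) (inj₂ (clean-right 5 ≤-eval ≤-eval p₂∈)) ◅ʰ
    at-hub p₂∈))
    where
    clean = clean-left 4 ≤-eval ≤-eval p∈
    p₁∈ = In-shift 729 p∈
    p₂∈ = In-shift 729 p₁∈

  -- Same detour with steps of 81 and 243, landing in `[568, 620]`, which is handled by
  -- `far-right-to-hub`.
  near-left-to-hub : ∀ {p} → In 325 377 p → ToHub (p + 81 * g)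
  near-left-to-hub {p} p∈ =
    Edge-sym (edge (shift 3 p refl ≤-eval) (near p∈) (near (In-shift 81 p∈)) (inj₁ clean)) ◅ʰ
    (edge (shift 4 p refl ≤-eval) (near p∈) (near p₁∈) (inj₁ clean) ◅ʰ
    far-right-to-hub (In-⊆ ≤-eval ≤-eval p₁∈))
    where
    clean = clean-left 3 ≤-eval ≤-eval p∈
    p₁∈ = In-shift 243 p∈

  unshifted : ∀ {a c p} j (Q : ℕ → Set) → (∀ {x} → In a c x → Q (x + j * g)) → In (a + j) (c + j) p → Q p
  unshifted {a} {c} {p} j Q f p∈ = subst Q e (f (In-unshift j (subst (In (a + j) (c + j)) (sym e) p∈)))
    where
    e : p ∸ j * g + j * g ≡ p
    e = m∸n+n≡m (≤-trans (≤-trans (*-monoˡ-≤ g (m≤n+m j a)) (m≤n+m _ o)) (lower p∈))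

  gap : ℕ → ℕ → ℕ → Bool
  gap a c = between (o + a * g) (o + c * g)

  gap-false : ∀ a c x → gap a c x ≡ false → x < o + a * g ⊎ o + c * g ≤ x
  gap-false a c = between-false (o + a * g) (o + c * g)

  -- The points whose distance to b is at most 28 or within 1 of 81: from there no
  -- shift is guaranteed to reach a clean point.
  bad : ℕ → Bool
  bad x = gap 404 406 x ∨ (gap 458 514 x ∨ gap 566 568 x)

  count-gap : ∀ a c s L → count (gap a (a + c)) s L ≤ c * g
  count-gap a c s L = begin
    count (gap a (a + c)) s L              ≤⟨ count-between (o + a * g) (o + (a + c) * g) s L ⟩
    (o + (a + c) * g) ∸ (o + a * g)        ≡⟨ cong (_∸ (o + a * g)) (split-offset o a g c) ⟩
    (o + a * g + c * g) ∸ (o + a * g)      ≡⟨ m+n∸m≡n (o + a * g) (c * g) ⟩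
    c * g                                  ∎
    where open ≤-Reasoning

  count-bad : ∀ s L → count bad s L ≤ 60 * g
  count-bad s L = begin
    count bad s L
      ≤⟨ count-⊆-∪ bad _ _ s L (λ x → ∨-true (gap 404 406 x) _) ⟩
    count (gap 404 406) s L + count (λ x → gap 458 514 x ∨ gap 566 568 x) s L
      ≤⟨ +-monoʳ-≤ _ (count-⊆-∪ _ _ _ s L (λ x → ∨-true (gap 458 514 x) _)) ⟩
    count (gap 404 406) s L + (count (gap 458 514) s L + count (gap 566 568) s L)
      ≤⟨ +-mono-≤ (count-gap 404 2 s L) (+-mono-≤ (count-gap 458 56 s L) (count-gap 566 2 s L)) ⟩
    2 * g + (56 * g + 2 * g)
      ≡⟨ cong (2 * g +_) (sym (*-distribʳ-+ g 56 2)) ⟩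
    2 * g + 58 * g
      ≡⟨ sym (*-distribʳ-+ g 2 58) ⟩
    60 * g ∎
    where open ≤-Reasoning

  good-to-hub : ∀ {p} → In 270 702 p → bad p ≡ false → ToHub p
  good-to-hub {p} (l , u) ok
    with gap-false 404 406 p (∨-falseˡ (gap 404 406 p) _ ok)
       | gap-false 458 514 p (∨-falseˡ (gap 458 514 p) _ (∨-falseʳ (gap 404 406 p) _ ok))
       | gap-false 566 568 p (∨-falseʳ (gap 458 514 p) _ (∨-falseʳ (gap 404 406 p) _ ok))
  ... | inj₁ a | _      | _      = unshifted 243 ToHub far-left-to-hub (l , <⇒≤ a)
  ... | inj₂ a | inj₁ b | _      = unshifted 81 ToHub near-left-to-hub (a , <⇒≤ b)
  ... | inj₂ _ | inj₂ b | inj₁ c = near-right-to-hub (b , <⇒≤ c)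
  ... | inj₂ _ | inj₂ _ | inj₂ c = far-right-to-hub (c , u)

  -- The bad points number at most `60 * g`, fewer than a third of a window of length `216 * g`.
  find-good : ∀ (f : ℕ → Bool) s L → 72 * g ≤ count f s L →
              ∃[ p ] (s ≤ p × p < s + L × f p ≡ true × bad p ≡ false)
  find-good f s L le = count-excess f bad s L
    (<-≤-trans (≤-<-trans (count-bad s L) (*-monoˡ-< g (≤-eval {61} {72}))) le)

  In-window : ∀ {a c b s p} w → In (a + w) c b → s ≤ b → b < s + w * g → s ≤ p → p < s + w * g → In a (c + w) p
  In-window {a} {c} {b} {s} {p} w (l , u) s≤b b<s+L s≤p p<s+L =
    +-cancelʳ-≤ (w * g) _ _ (begin
      o + a * g + w * g   ≡⟨ sym (split-offset o a g w) ⟩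
      o + (a + w) * g     ≤⟨ l ⟩
      b                   ≤⟨ <⇒≤ b<s+L ⟩
      s + w * g           ≤⟨ +-monoˡ-≤ _ s≤p ⟩
      p + w * g           ∎) ,
    (begin
      p                   ≤⟨ <⇒≤ p<s+L ⟩
      s + w * g           ≤⟨ +-monoˡ-≤ _ (≤-trans s≤b u) ⟩
      o + c * g + w * g   ≡⟨ sym (split-offset o c g w) ⟩
      o + (c + w) * g     ∎)
    where open ≤-Reasoning

  complement-count : ∀ χ s L a c → (a + c) * g ≡ L → count χ s L ≤ a * g → c * g ≤ count (not ∘ χ) s L
  complement-count χ s L a c e hi = +-cancelˡ-≤ (a * g) _ _ (begin
    a * g + c * g                            ≡⟨ sym (*-distribʳ-+ g a c) ⟩
    (a + c) * g                              ≡⟨ trans e (sym (count-not χ s L)) ⟩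
    count χ s L + count (not ∘ χ) s L        ≤⟨ +-monoˡ-≤ _ hi ⟩
    a * g + count (not ∘ χ) s L              ∎)
    where open ≤-Reasoning

  In-near : ∀ {a b z} → In (a + 1) (a + 1) b → Near b g z → In a (a + 1 + 1) z
  In-near {a} {b} {z} (l , u) (b≤z+g , z≤b+g) =
    +-cancelʳ-≤ (1 * g) _ _ (begin
      o + a * g + 1 * g       ≡⟨ sym (split-offset o a g 1) ⟩
      o + (a + 1) * g         ≤⟨ l ⟩
      b                       ≤⟨ b≤z+g ⟩
      z + g                   ≡⟨ cong (z +_) (sym (*-identityˡ g)) ⟩
      z + 1 * g               ∎) ,
    (begin
      z                       ≤⟨ z≤b+g ⟩
      b + g                   ≡⟨ cong (b +_) (sym (*-identityˡ g)) ⟩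
      b + 1 * g               ≤⟨ +-monoˡ-≤ _ u ⟩
      o + (a + 1) * g + 1 * g ≡⟨ sym (split-offset o (a + 1) g 1) ⟩
      o + (a + 1 + 1) * g     ∎)
    where open ≤-Reasoning

  near-In : ∀ {a c b z} → In a a b → In 0 (a + c) z → b ≤ z + a * g × z ≤ b + c * g
  near-In {a} {c} {b} {z} (l , u) (l′ , u′) =
    (begin
      b                       ≤⟨ u ⟩
      o + a * g               ≡⟨ cong (_+ a * g) (sym (+-identityʳ o)) ⟩
      o + 0 * g + a * g       ≤⟨ +-monoˡ-≤ _ l′ ⟩
      z + a * g               ∎) ,
    (begin
      z                       ≤⟨ u′ ⟩
      o + (a + c) * g         ≡⟨ split-offset o a g c ⟩
      o + a * g + c * g       ≤⟨ +-monoˡ-≤ _ l ⟩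
      b + c * g               ∎)
    where open ≤-Reasoning

  -- A good point of `χ` and a good point of its complement exist, and both reach the hub. The path
  -- joining them through the hub must cross the cut.
  crossing-edge : ∀ (χ : ℕ → Bool) b s → In 486 486 b → s ≤ b → b < s + 216 * g →
                  72 * g ≤ count χ s (216 * g) → count χ s (216 * g) ≤ 144 * g →
                  ∃[ x ] ∃[ y ] (Edge x y × χ x ≡ true × χ y ≡ false)
  crossing-edge χ b s b∈ s≤b b<s+L lo hi =
    let p , s≤p , p<s+L , χp , good-p = find-good χ s _ lo
        q , s≤q , q<s+L , χq , good-q = find-good (not ∘ χ) s _ (complement-count χ s _ 144 72 refl hi)
        z  , z∈  , p→z  = good-to-hub (In-window 216 b∈ s≤b b<s+L s≤p p<s+L) good-p
        z′ , z′∈ , q→z′ = good-to-hub (In-window 216 b∈ s≤b b<s+L s≤q q<s+L) good-q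
    in crossing χ (p→z ◅◅ hub-path z z′ z∈ z′∈ ◅◅ path-sym q→z′) χp (not-true χq)
    where
    not-true : ∀ {β} → not β ≡ true → β ≡ false
    not-true {false} e = refl

  -- Restates the crossing edge by distances from `b`: 1198 is `1684 - 486`, and the interval
  -- `[485, 487]` becomes the ball of radius `g`.
  new-pair : ∀ (χ : ℕ → Bool) b s → o + 486 * g ≡ b → s ≤ b → b < s + 216 * g →
             72 * g ≤ count χ s (216 * g) → count χ s (216 * g) ≤ 144 * g →
             ∃[ x ] ∃[ y ] (χ x ≡ true × χ y ≡ false × Adjacent h x y ×
               Near b (1198 * g) x × Near b (1198 * g) y ×
               ((∀ z → Near b g z → ¬ Adjacent h x z) ⊎ (∀ z → Near b g z → ¬ Adjacent h y z)))
  new-pair χ b s o+≡b s≤b b<s+L lo hi =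
    let x , y , edge adj x∈ y∈ clean , χx , χy = crossing-edge χ b s b∈ s≤b b<s+L lo hi
    in x , y , χx , χy , adj , close x∈ , close y∈ , map far far clean
    where
    b∈ : In 486 486 b
    b∈ = ≤-reflexive o+≡b , ≤-reflexive (sym o+≡b)
    close : ∀ {z} → In 0 1684 z → Near b (1198 * g) z
    close {z} z∈ =
      ≤-trans (proj₁ (near-In {486} {1198} b∈ z∈)) (+-monoʳ-≤ z (*-monoˡ-≤ g (≤-eval {486} {1198}))) ,
      proj₂ (near-In {486} {1198} b∈ z∈)
    far : ∀ {x} → Clean x → ∀ z → Near b g z → ¬ Adjacent h x z
    far c z z∈ = c z (In-near {485} b∈ z∈)

-- Separated pairs from nested scales

-- Consecutive scales are 7 levels apart: 3 ^ 7 exceeds both the radius 1198 around b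
-- of a new edge and the room 486 + 216 + 1480 needed around the largest window.
module Recursion (h n G : ℕ) (χ : ℕ → Bool) where

  Separated : ℕ → ℕ → Set
  Separated u v = ∃[ w ] (w < n × χ w ≡ false ×
    ((Adjacent h u w × ¬ Adjacent h v w) ⊎ (Adjacent h v w × ¬ Adjacent h u w)))

  -- The edges `x j`, `y j` across the cut cluster within `ρ` of one point `b` of the window at `s`;
  -- a larger scale needs only this radius to separate its new edge from them.
  record Pairs (i g ρ s : ℕ) : Set where
    field
      b     : ℕ
      s≤b   : s ≤ b
      b<s+L : b < s + 216 * g
      x y   : Fin i → ℕ
      x<n   : ∀ j → x j < n
      y<n   : ∀ j → y j < n
      χx    : ∀ j → χ (x j) ≡ true
      χy    : ∀ j → χ (y j) ≡ false
      near  : ∀ j → Near b ρ (x j) × Near b ρ (y j)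
      adj   : ∀ j → Adjacent h (x j) (y j)
      sep   : ∀ j k → j ≢ k → Separated (x j) (x k)

  extend : ∀ {i κ g g₀ ρ r s} → 3 ^ κ ≡ g → 5 + κ ≤ h → 486 * G ≤ s → s + 216 * g + 1480 * G ≤ n → g ≤ G →
           72 * g ≤ count χ s (216 * g) → count χ s (216 * g) ≤ 144 * g → 2187 * g ≤ ρ →
           s ≤ r → r + 216 * g₀ ≤ s + 216 * g → Pairs i g₀ g r → Pairs (suc i) g ρ s
  extend {i} {κ} {g} {g₀} {ρ} {r} {s} 3^κ≡g κ+5≤h m₁ m₂ g≤G lo hi g≤ρ s≤r r+L≤ Q =
    let u , v , χu , χv , adjacent , u∈ , v∈ , clean = new in record
    { b = b ; s≤b = s≤b′ ; b<s+L = b<s+L′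
    ; x = λ { zero → u ; (suc j) → x j }
    ; y = λ { zero → v ; (suc j) → y j }
    ; x<n = λ { zero → bound u∈ ; (suc j) → x<n j }
    ; y<n = λ { zero → bound v∈ ; (suc j) → y<n j }
    ; χx = λ { zero → χu ; (suc j) → χx j }
    ; χy = λ { zero → χv ; (suc j) → χy j }
    ; near = λ { zero → Near-≤ 1198g≤ρ u∈ , Near-≤ 1198g≤ρ v∈
               ; (suc j) → Near-≤ g≤ρ′ (proj₁ (near j)) , Near-≤ g≤ρ′ (proj₂ (near j)) }
    ; adj = λ { zero → adjacent ; (suc j) → adj j }
    ; sep = λ { zero    zero    j≢k → contradiction refl j≢k
              ; zero    (suc k) _   → separate (bound v∈) χv adjacent clean k
              ; (suc j) zero    _   → flip (separate (bound v∈) χv adjacent clean j)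
              ; (suc j) (suc k) j≢k → sep j k (j≢k ∘ cong suc) }
    }
    where
    open Pairs Q
    s≤b′ : s ≤ b
    s≤b′ = ≤-trans s≤r s≤b
    b<s+L′ : b < s + 216 * g
    b<s+L′ = <-≤-trans b<s+L r+L≤
    -- The origin puts `b` at position 486; the margin `486 * G` to the left of the largest window
    -- makes the subtraction exact.
    new = Scale.new-pair h κ g (b ∸ 486 * g) 3^κ≡g κ+5≤h χ b s
            (m∸n+n≡m (≤-trans (*-monoʳ-≤ 486 g≤G) (≤-trans m₁ s≤b′))) s≤b′ b<s+L′ lo hi
    bound : ∀ {z} → Near b (1198 * g) z → z < n
    bound {z} (_ , z≤) = begin-strict
      z                                ≤⟨ z≤ ⟩
      b + 1198 * g                     <⟨ +-monoˡ-< _ b<s+L′ ⟩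
      s + 216 * g + 1198 * g           ≤⟨ +-monoʳ-≤ (s + 216 * g) (*-mono-≤ (≤-eval {1198} {1480}) g≤G) ⟩
      s + 216 * g + 1480 * G           ≤⟨ m₂ ⟩
      n                                ∎
      where open ≤-Reasoning
    1198g≤ρ : 1198 * g ≤ ρ
    1198g≤ρ = ≤-trans (*-monoˡ-≤ g (≤-eval {1198} {2187})) g≤ρ
    g≤ρ′ : g ≤ ρ
    g≤ρ′ = ≤-trans (m≤n*m g 2187) g≤ρ
    -- If `u` is clean, the old `y k` sees `x k` but not `u`. If `v` is clean, `v` sees `u` but not
    -- `x k`.
    separate : ∀ {u v} → v < n → χ v ≡ false → Adjacent h u v →
               (∀ z → Near b g z → ¬ Adjacent h u z) ⊎ (∀ z → Near b g z → ¬ Adjacent h v z) →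
               ∀ k → Separated u (x k)
    separate v<n χv a (inj₁ c) k = y k , y<n k , χy k , inj₂ (adj k , c (y k) (proj₂ (near k)))
    separate v<n χv a (inj₂ c) k = _ , v<n , χv , inj₁ (a , c (x k) (proj₁ (near k)) ∘ Adjacent-sym {h})
    flip : ∀ {u v} → Separated u v → Separated v u
    flip (w , w<n , χw , d) = w , w<n , χw , swap d

  narrow : ∀ {g} s g₀ → g ≡ 3 ^ 7 * g₀ → 72 * g ≤ count χ s (216 * g) → count χ s (216 * g) ≤ 144 * g →
           ∃[ r ] (s ≤ r × r + 216 * g₀ ≤ s + 216 * g ×
                   72 * g₀ ≤ count χ r (216 * g₀) × count χ r (216 * g₀) ≤ 144 * g₀)
  narrow s g₀ refl lo hi = subwindow χ s (3 ^ 7) g₀ 216 (≤-eval {72} {144}) lo hi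

  -- The point `b` is fixed in the innermost window and lies in all outer ones. The edges of the
  -- previous scale `κ₀` lie within `2187 * 3 ^ κ₀`, which equals `3 ^ κ`, so they are one unit from
  -- `b` at the present scale.
  build : ∀ i κ {ρ} s → κ ≡ i * 7 → 5 + κ ≤ h → 486 * G ≤ s → s + 216 * 3 ^ κ + 1480 * G ≤ n → 3 ^ κ ≤ G →
          72 * 3 ^ κ ≤ count χ s (216 * 3 ^ κ) → count χ s (216 * 3 ^ κ) ≤ 144 * 3 ^ κ → 2187 * 3 ^ κ ≤ ρ →
          Pairs i (3 ^ κ) ρ s
  build zero κ s _ _ _ _ _ _ _ _ = record
    { b = s ; s≤b = ≤-refl ; b<s+L = m<m+n s (≤-trans (m^n>0 3 κ) (m≤n*m (3 ^ κ) 216))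
    ; x = λ () ; y = λ () ; x<n = λ () ; y<n = λ () ; χx = λ () ; χy = λ ()
    ; near = λ () ; adj = λ () ; sep = λ () }
  build (suc i) κ s κ≡ κ+5≤h m₁ m₂ g≤G lo hi g≤ρ = step (i * 7) refl κ≡
    where
    step : ∀ κ₀ → κ₀ ≡ i * 7 → κ ≡ 7 + κ₀ → Pairs (suc i) (3 ^ κ) _ s
    step κ₀ κ₀≡ κ≡7+κ₀ =
      let e = trans (cong (3 ^_) κ≡7+κ₀) (^-distribˡ-+-* 3 7 κ₀)
          r , s≤r , r+L≤ , lo′ , hi′ = narrow s (3 ^ κ₀) e lo hi
          κ₀≤κ = ≤-trans (m≤n+m κ₀ 7) (≤-reflexive (sym κ≡7+κ₀))
      in extend refl κ+5≤h m₁ m₂ g≤G lo hi g≤ρ s≤r r+L≤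
           (build i κ₀ r κ₀≡ (≤-trans (+-monoʳ-≤ 5 κ₀≤κ) κ+5≤h) (≤-trans m₁ s≤r)
             (≤-trans (+-monoˡ-≤ _ r+L≤) m₂) (≤-trans (^-monoʳ-≤ 3 κ₀≤κ) g≤G) lo′ hi′
             (≤-reflexive (sym e)))

-- Components of the red graphs

-- Decides reachability as in Warshall's algorithm: the list holds the allowed inner vertices.
module Warshall {V : Set} (R : V → V → Set) (R? : ∀ x y → Dec (R x y)) where

  Via : List V → V → V → Set
  Via []       x y = R x y
  Via (z ∷ zs) x y = Via zs x y ⊎ (Via zs x z × Via zs z y)

  via? : ∀ zs x y → Dec (Via zs x y)
  via? []       x y = R? x y
  via? (z ∷ zs) x y = via? zs x y ⊎-dec (via? zs x z ×-dec via? zs z y)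

  via⇒star : ∀ zs {x y} → Via zs x y → Star R x y
  via⇒star []       r              = return r
  via⇒star (z ∷ zs) (inj₁ p)       = via⇒star zs p
  via⇒star (z ∷ zs) (inj₂ (p , q)) = via⇒star zs p ◅◅ via⇒star zs q

  edge⇒via : ∀ zs {x y} → R x y → Via zs x y
  edge⇒via []       r = r
  edge⇒via (z ∷ zs) r = inj₁ (edge⇒via zs r)

  to-head : ∀ z zs {x} → Via (z ∷ zs) x z → Via zs x z
  to-head z zs (inj₁ p)       = p
  to-head z zs (inj₂ (p , _)) = p

  from-head : ∀ z zs {y} → Via (z ∷ zs) z y → Via zs z y
  from-head z zs (inj₁ q)       = q
  from-head z zs (inj₂ (_ , q)) = q

  via-trans : ∀ zs {x y w} → w ∈ zs → Via zs x w → Via zs w y → Via zs x y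
  via-trans (z ∷ zs) (here refl) p q = inj₂ (to-head z zs p , from-head z zs q)
  via-trans (z ∷ zs) (there w∈) (inj₁ p) (inj₁ q) = inj₁ (via-trans zs w∈ p q)
  via-trans (z ∷ zs) (there w∈) (inj₁ p) (inj₂ (q₁ , q₂)) = inj₂ (via-trans zs w∈ p q₁ , q₂)
  via-trans (z ∷ zs) (there w∈) (inj₂ (p₁ , p₂)) (inj₁ q) = inj₂ (p₁ , via-trans zs w∈ p₂ q)
  -- When both halves visit `z`, everything between the arrival of the first and the departure of
  -- the second is cut out.
  via-trans (z ∷ zs) (there w∈) (inj₂ (p₁ , _)) (inj₂ (_ , q₂)) = inj₂ (p₁ , q₂)

  star? : (zs : List V) → (∀ z → z ∈ zs) → (∀ z → R z z) → ∀ x y → Dec (Star R x y)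
  star? zs all R-refl x y = map′ (via⇒star zs) star⇒via (via? zs x y)
    where
    star⇒via : ∀ {x y} → Star R x y → Via zs x y
    star⇒via ε        = edge⇒via zs (R-refl _)
    star⇒via (r ◅ rs) = via-trans zs (all _) (edge⇒via zs r) (star⇒via rs)

does-true : ∀ {A : Set} (a? : Dec A) → does a? ≡ true → A
does-true (yes a) _ = a

does-false : ∀ {A : Set} (a? : Dec A) → does a? ≡ false → ¬ A
does-false (no ¬a) _ = ¬a

-- Descends from `N` while `Q` holds and stops where it first fails: a switch from failure to
-- success.
first-success : ∀ {Q : ℕ → Set} → (∀ k → Dec (Q k)) → ∀ N → ¬ Q 0 → Q N → ∃[ k ] (k < N × ¬ Q k × Q (suc k))
first-success Q? zero    ¬q₀ q = contradiction q ¬q₀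
first-success Q? (suc N) ¬q₀ q with Q? N
... | no ¬qN = N , ≤-refl , ¬qN , q
... | yes qN with first-success Q? N ¬q₀ qN
...   | k , k<N , r = k , m<n⇒m<1+n k<N , r

module _ {n : ℕ} where

  -- The default `false` ensures that only actual leaves are counted in a window.
  extend-false : (Fin n → Bool) → ℕ → Bool
  extend-false f x with x <? n
  ... | yes x<n = f (fromℕ< x<n)
  ... | no  _   = false

  extend-false-toℕ : ∀ f i → extend-false f (toℕ i) ≡ f i
  extend-false-toℕ f i with toℕ i <? n
  ... | yes i<n = cong f (fromℕ<-toℕ i i<n)
  ... | no  i≮n = contradiction (toℕ<n i) i≮n

  extend-false-true : ∀ f x → extend-false f x ≡ true → ∃[ i ] (toℕ i ≡ x × f i ≡ true)
  extend-false-true f x e with x <? n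
  ... | yes x<n = fromℕ< x<n , toℕ-fromℕ< x<n , e

  extend-false-< : ∀ f {x} (x<n : x < n) {β} → extend-false f x ≡ β → f (fromℕ< x<n) ≡ β
  extend-false-< f {x} x<n e = trans (sym (extend-false-toℕ f (fromℕ< x<n)))
    (trans (cong (extend-false f) (toℕ-fromℕ< x<n)) e)

module Sequence (h : ℕ) (P : PartitionSequence (3 ^ h)) where

  n : ℕ
  n = 3 ^ h

  V : Set
  V = Fin n

  Dist3? : ∀ i j → Dec (Dist3 i j)
  Dist3? i j = (i ≟ j + 3) ⊎-dec (j ≟ i + 3)

  adjacent? : ∀ x y → Dec (Adjacent h x y)
  adjacent? x y = map′ (λ (l , l<1+h , d) → l , ≤-pred l<1+h , d) (λ (l , l≤h , d) → l , s≤s l≤h , d)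
    (anyUpTo? (λ l → Dist3? (anc l x) (anc l y)) (suc h))

  Same? : ∀ k u v → Dec (Same P k u v)
  Same? k u v = lab P k u ≟ lab P k v

  Red? : ∀ k x y → Dec (Red (A3 h) P k x y)
  Red? k x y = ¬? (Same? k x y) ×-dec
    any? λ u → any? λ u′ → any? λ v → any? λ v′ →
      Same? k u x ×-dec Same? k u′ x ×-dec Same? k v y ×-dec Same? k v′ y ×-dec
      adjacent? (toℕ u) (toℕ v) ×-dec ¬? (adjacent? (toℕ u′) (toℕ v′))

  Red-sym : ∀ {k x y} → Red (A3 h) P k x y → Red (A3 h) P k y x
  Red-sym (x≁y , u , u′ , v , v′ , su , su′ , sv , sv′ , a , ¬a) =
    x≁y ∘ sym , v , v′ , u , u′ , sv , sv′ , su , su′ , Adjacent-sym {h} a , ¬a ∘ Adjacent-sym {h}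

  -- Allowing `Same` steps lets components be classes of vertices instead of parts: a class of
  -- `Linked` is the union of the parts in one red component.
  Link : ℕ → V → V → Set
  Link k x y = Same P k x y ⊎ Red (A3 h) P k x y

  Link-sym : ∀ {k x y} → Link k x y → Link k y x
  Link-sym {k} (inj₁ s) = inj₁ (sym s)
  Link-sym {k} (inj₂ r) = inj₂ (Red-sym {k} r)

  Linked : ℕ → V → V → Set
  Linked k = Star (Link k)

  Linked-sym : ∀ {k x y} → Linked k x y → Linked k y x
  Linked-sym {k} = reverse (Link-sym {k})

  linked? : ∀ k x y → Dec (Linked k x y)
  linked? k = Warshall.star? (Link k) (λ x y → Same? k x y ⊎-dec Red? k x y) (allFin n) ∈-allFin (λ _ → inj₁ refl)

  Same-suc : ∀ {k} → suc k < n → ∀ {u v} → Same P k u v → Same P (suc k) u v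
  Same-suc {k} k<n {u} {v} s = let _ , _ , _ , equiv = merge P k k<n in Equivalence.from (equiv u v) (inj₁ s)

  -- The witnesses of a red edge survive a merge unless its two ends fall into one part. Hence
  -- components at stage `suc k` are unions of components at stage `k`.
  Link-suc : ∀ {k} → suc k < n → ∀ {x y} → Link k x y → Link (suc k) x y
  Link-suc k<n (inj₁ s) = inj₁ (Same-suc k<n s)
  Link-suc {k} k<n {x} {y} (inj₂ (_ , u , u′ , v , v′ , su , su′ , sv , sv′ , a)) with Same? (suc k) x y
  ... | yes s = inj₁ s
  ... | no ¬s = inj₂ (¬s , u , u′ , v , v′ , up su , up su′ , up sv , up sv′ , a)
    where
    up : ∀ {u v} → Same P k u v → Same P (suc k) u v
    up = Same-suc k<n

  Linked-suc : ∀ {k} → suc k < n → ∀ {x y} → Linked k x y → Linked (suc k) x y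
  Linked-suc k<n = gmap id (Link-suc k<n)

  -- Redness depends only on the parts, so a `Same` step is absorbed by changing the endpoint of a
  -- neighbouring red edge.
  Linked⇒Red* : ∀ {k x y} → Linked k x y → Same P k x y ⊎ Star (Red (A3 h) P k) x y
  Linked⇒Red* ε = inj₁ refl
  Linked⇒Red* (inj₂ r ◅ ls) with Linked⇒Red* ls
  ... | inj₂ rs = inj₂ (r ◅ rs)
  ... | inj₁ s  = inj₂ (redirect r s ◅ ε)
    where
    redirect : ∀ {k x y z} → Red (A3 h) P k x y → Same P k y z → Red (A3 h) P k x z
    redirect (¬s , u , u′ , v , v′ , su , su′ , sv , sv′ , a) s =
      (λ s′ → ¬s (trans s′ (sym s))) , u , u′ , v , v′ , su , su′ , trans sv s , trans sv′ s , a
  Linked⇒Red* (inj₁ s ◅ ls) with Linked⇒Red* ls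
  ... | inj₁ s′ = inj₁ (trans s s′)
  ... | inj₂ ε  = inj₁ s
  ... | inj₂ ((¬s , u , u′ , v , v′ , su , su′ , r) ◅ rs) =
    inj₂ (((λ s′ → ¬s (trans (sym s) s′)) , u , u′ , v , v′ , trans su (sym s) , trans su′ (sym s) , r) ◅ rs)

  Linked-start : ∀ {x y} → Linked 0 x y → x ≡ y
  Linked-start ε = refl
  Linked-start (inj₁ s ◅ ls) = trans (start P _ _ s) (Linked-start ls)
  Linked-start (inj₂ (_ , u , u′ , v , v′ , su , su′ , sv , sv′ , a , ¬a) ◅ ls) =
    contradiction (subst₂ (λ i j → Adjacent h (toℕ i) (toℕ j))
      (start P _ _ (trans su (sym su′))) (start P _ _ (trans sv (sym sv′))) a) ¬a

  -- A union of components holding between one and two thirds of the window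

  module Split (κ : ℕ) (fits : 486 * 3 ^ κ + 216 * 3 ^ κ + 1480 * 3 ^ κ ≤ n) where

    s L : ℕ
    s = 486 * 3 ^ κ
    L = 216 * 3 ^ κ

    θ : ℕ
    θ = 72 * 3 ^ κ

    weight : (V → Bool) → ℕ
    weight f = count (extend-false f) s L

    weight-excess : ∀ f g → weight g < weight f → ∃[ v ] (f v ≡ true × g v ≡ false)
    weight-excess f g lt =
      let x , _ , _ , fx , gx = count-excess (extend-false f) (extend-false g) s L lt
          v , v≡x , fv = extend-false-true f x fx
      in v , fv , trans (sym (extend-false-toℕ g v)) (trans (cong (extend-false g) v≡x) gx)

    weight-∪ : ∀ f g h → (∀ v → f v ≡ true → g v ≡ true ⊎ h v ≡ true) → weight f ≤ weight g + weight h
    weight-∪ f g h c = count-⊆-∪ _ _ _ s L λ x fx →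
      let v , v≡x , fv = extend-false-true f x fx
          lift : ∀ g → g v ≡ true → extend-false g x ≡ true
          lift g gv = trans (cong (extend-false g) (sym v≡x)) (trans (extend-false-toℕ g v) gv)
      in map (lift g) (lift h) (c v fv)

    1<θ : 1 < θ
    1<θ = *-mono-≤ (≤-eval {2} {72}) (m^n>0 3 κ)

    component : ℕ → V → V → Bool
    component k z v = does (linked? k z v)

    Large : ℕ → Set
    Large k = ∃[ z ] (θ ≤ weight (component k z))

    ¬large-start : ¬ Large 0
    ¬large-start (z , θ≤)
      with count-excess (extend-false (component 0 z)) (between (toℕ z) (suc (toℕ z))) s L
             (≤-<-trans (count-between (toℕ z) (suc (toℕ z)) s L) (≤-<-trans (≤-reflexive (m+n∸n≡m 1 (toℕ z))) (<-≤-trans 1<θ θ≤)))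
    ... | x , _ , _ , cx , x≢z with extend-false-true _ x cx
    ...   | v , v≡x , cv
      with trans (cong toℕ (Linked-start (does-true (linked? 0 z v) cv))) v≡x
         | between-false (toℕ z) (suc (toℕ z)) x x≢z
    ...     | z≡x | inj₁ x<z = <-irrefl (sym z≡x) x<z
    ...     | z≡x | inj₂ z<x = <-irrefl z≡x z<x

    large-finish : Large (n ∸ 1)
    large-finish = z , ≮⇒≥ λ lt →
      let x , _ , x<s+L , _ , cx = count-excess (λ _ → true) (extend-false (component (n ∸ 1) z)) s L
                            (<-≤-trans lt (≤-trans (*-monoˡ-≤ (3 ^ κ) (≤-eval {72} {216})) (≤-reflexive (sym (count-true s L)))))
          x<n = <-≤-trans x<s+L (≤-trans (m≤m+n (s + L) _) fits)
      in does-false (linked? (n ∸ 1) z _) (extend-false-< (component (n ∸ 1) z) x<n cx) (inj₁ (finish P z _) ◅ ε)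
      where
      z : V
      z = fromℕ< (m^n>0 3 h)

    module _ (k : ℕ) (z : V) where

      -- The greedy union: stage `k` components inside the stage `suc k` component of `z`, added in
      -- the order of the vertices `i` that represent them.
      Union : ℕ → V → Set
      Union j v = ∃[ i ] (toℕ i < j × Linked (suc k) z i × Linked k i v)

      union? : ∀ j v → Dec (Union j v)
      union? j v = any? λ i → (toℕ i <? j) ×-dec linked? (suc k) z i ×-dec linked? k i v

      union : ℕ → V → Bool
      union j v = does (union? j v)

      Union-Linked : ∀ {j u v} → Union j u → Linked k u v → Union j v
      Union-Linked (i , i<j , zi , iu) uv = i , i<j , zi , iu ◅◅ uv

      ¬heavy-start : ¬ (θ ≤ weight (union 0))
      ¬heavy-start θ≤ =
        let x , _ , _ , ux , _ = count-excess (extend-false (union 0)) (between 0 0) s L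
              (≤-<-trans (count-between 0 0 s L) (<-≤-trans (<⇒≤ 1<θ) θ≤))
            v , _ , uv = extend-false-true (union 0) x ux
            _ , i<0 , _ = does-true (union? 0 v) uv
        in n≮0 i<0

      heavy-finish : θ ≤ weight (component (suc k) z) → θ ≤ weight (union n)
      heavy-finish θ≤ = ≮⇒≥ λ lt →
        let v , cv , uv = weight-excess (component (suc k) z) (union n) (<-≤-trans lt θ≤)
        in does-false (union? n v) uv (v , toℕ<n v , does-true (linked? (suc k) z v) cv , ε)

      union-step : ∀ {j} (j<n : j < n) → weight (union (suc j)) ≤ weight (union j) + weight (component k (fromℕ< j<n))
      union-step {j} j<n = weight-∪ _ _ _ λ v uv → step v (does-true (union? (suc j) v) uv)
        where
        step : ∀ v → Union (suc j) v → union j v ≡ true ⊎ component k (fromℕ< j<n) v ≡ true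
        step v (i , i<1+j , zi , iv) = map
          (λ i<j → dec-true (union? j v) (i , i<j , zi , iv))
          (λ i≡j → dec-true (linked? k _ v)
            (subst (λ w → Linked k w v) (toℕ-injective (trans i≡j (sym (toℕ-fromℕ< j<n)))) iv))
          (m<1+n⇒m<n∨m≡n i<1+j)

    record BalancedUnion : Set where
      field
        k      : ℕ
        1+k<n  : suc k < n
        z      : V
        j      : ℕ
        heavy  : θ ≤ weight (union k z j)
        light  : weight (union k z j) ≤ 144 * 3 ^ κ

    balancedUnion : BalancedUnion
    balancedUnion =
      let k , k<n∸1 , ¬large , z , θ≤ =
            first-success (λ k → any? λ z → θ ≤? weight (component k z)) (n ∸ 1) ¬large-start large-finish
          j , j<n , ¬heavy , heavy =
            first-success (λ j → θ ≤? weight (union k z j)) n (¬heavy-start k z) (heavy-finish k z θ≤)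
          -- No component of stage `k` weighs `θ`, so the step that first reaches `θ` ends below
          -- `2 * θ`, which is two thirds of the window.
          gain<θ = ≰⇒> (λ le → ¬large (fromℕ< j<n , le))
      in record
        { k = k ; 1+k<n = <-≤-trans (s≤s k<n∸1) (≤-reflexive (m+[n∸m]≡n (m^n>0 3 h)))
        ; z = z ; j = suc j ; heavy = heavy
        ; light = ≤-trans (union-step k z j<n)
            (≤-trans (+-mono-≤ (<⇒≤ (≰⇒> ¬heavy)) (<⇒≤ gain<θ))
                     (≤-reflexive (sym (*-distribʳ-+ (3 ^ κ) 72 72))))
        }

  -- A large red component from the separated vertices

  module RedComponent (t κ : ℕ) (κ≡ : κ ≡ suc t * 7) (5+κ≤h : 5 + κ ≤ h)
                 (fits : 486 * 3 ^ κ + 216 * 3 ^ κ + 1480 * 3 ^ κ ≤ n) where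

    open Split κ fits
    open BalancedUnion balancedUnion

    χ : ℕ → Bool
    χ = extend-false (union k z j)

    open Recursion h n (3 ^ κ) χ

    pairs : Pairs (suc t) (3 ^ κ) _ s
    pairs = build (suc t) κ s κ≡ 5+κ≤h ≤-refl fits ≤-refl heavy light ≤-refl

    open Pairs pairs using (x; x<n; χx; sep)

    W : V → Set
    W = Union k z j

    f : Fin (suc t) → V
    f i = fromℕ< (x<n i)

    f∈W : ∀ i → W (f i)
    f∈W i = does-true (union? k z j (f i)) (extend-false-< (union k z j) (x<n i) (χx i))

    -- The parts of `u` and `w` would be equal or inhomogeneous, so `w` would be linked to `u` at
    -- stage `k`; but `W` is closed under these links.
    W-twins : ∀ {u u′ w} → W u → ¬ W w → Same P k u u′ → Adj (A3 h) u w → ¬ Adj (A3 h) u′ w → ⊥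
    W-twins {u} {u′} {w} u∈ w∉ s a ¬a = w∉ (Union-Linked k z u∈ (link (Same? k u w) ◅ ε))
      where
      link : Dec (Same P k u w) → Link k u w
      link (yes su) = inj₁ su
      link (no ¬su) = inj₂ (¬su , u , u′ , w , w , refl , sym s , refl , refl , a , ¬a)

    ¬same : ∀ i l → Separated (x i) (x l) → ¬ Same P k (f i) (f l)
    ¬same i l (w , w<n , χw , d) same = [ separate i l same , separate l i (sym same) ]′ d
      where
      w′ : V
      w′ = fromℕ< w<n
      w∉ : ¬ W w′
      w∉ = does-false (union? k z j w′) (extend-false-< (union k z j) w<n χw)
      separate : ∀ i l → Same P k (f i) (f l) → Adjacent h (x i) w × ¬ Adjacent h (x l) w → ⊥
      separate i l same (a , ¬a) = W-twins (f∈W i) w∉ same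
        (subst₂ (Adjacent h) (sym (toℕ-fromℕ< (x<n i))) (sym (toℕ-fromℕ< w<n)) a)
        (¬a ∘ subst₂ (Adjacent h) (toℕ-fromℕ< (x<n l)) (toℕ-fromℕ< w<n))

    distinct : ∀ i l → i ≢ l → ¬ Same P k (f i) (f l)
    distinct i l i≢l = ¬same i l (sep i l i≢l)

    -- Once the parts of a and b are merged, two of the vertices f i share a part only
    -- if one of them lies in the part of a; at most one does, and it is dropped.
    avoiding : ∀ a → ∃[ p ] (∀ i → ¬ Same P k (f (punchIn p i)) a)
    avoiding a = pivot (any? (λ i → Same? k (f i) a))
      where
      pivot : Dec (∃[ i ] Same P k (f i) a) → ∃[ p ] (∀ i → ¬ Same P k (f (punchIn p i)) a)
      pivot (yes (p , s)) = p , λ i s′ → distinct (punchIn p i) p (punchInᵢ≢i p i) (trans s′ (sym s))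
      pivot (no ¬s)       = zero , λ i s′ → ¬s (suc i , s′)

    distinct-after-merge : ∃[ p ] (∀ (i l : Fin t) → i ≢ l → ¬ Same P (suc k) (f (punchIn p i)) (f (punchIn p l)))
    distinct-after-merge =
      let a , _ , _ , equiv = merge P k 1+k<n
          p , ≁a = avoiding a
      in p , λ i l i≢l s →
        [ distinct (punchIn p i) (punchIn p l) (i≢l ∘ punchIn-injective p i l) , [ ≁a i ∘ proj₁ , ≁a l ∘ proj₂ ]′ ]′
        (Equivalence.to (equiv (f (punchIn p i)) (f (punchIn p l))) s)

    -- The separation holds at stage `k`, the connection through `z` only at stage `suc k`; the
    -- merge between them costs one of the `suc t` vertices.
    red-component : HasRedComponentOfSize (A3 h) P (suc k) t
    red-component = f′ , ≁ , λ i l → connected (i Fin.≟ l)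
      where
      p : Fin (suc t)
      p = proj₁ distinct-after-merge
      f′ : Fin t → V
      f′ = f ∘ punchIn p
      ≁ : ∀ i l → i ≢ l → ¬ Same P (suc k) (f′ i) (f′ l)
      ≁ = proj₂ distinct-after-merge
      z-linked : ∀ i → Linked (suc k) z (f′ i)
      z-linked i = let _ , _ , zv , vi = f∈W (punchIn p i) in zv ◅◅ Linked-suc 1+k<n vi
      connected : ∀ {i l} → Dec (i ≡ l) → Star (Red (A3 h) P (suc k)) (f′ i) (f′ l)
      connected (yes refl) = ε
      connected {i} {l} (no i≢l) =
        [ (λ s → contradiction s (≁ i l i≢l)) , id ]′ (Linked⇒Red* (Linked-sym (z-linked i) ◅◅ z-linked l))

    stage : ∃[ k ] (k < n × HasRedComponentOfSize (A3 h) P k t)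
    stage = suc k , 1+k<n , red-component

-- The bound in terms of the height

fits-power : ∀ h κ → 7 + κ ≤ h → 486 * 3 ^ κ + 216 * 3 ^ κ + 1480 * 3 ^ κ ≤ 3 ^ h
fits-power h κ 7+κ≤h = begin
  486 * G + 216 * G + 1480 * G  ≡⟨ cong (_+ 1480 * G) (sym (*-distribʳ-+ G 486 216)) ⟩
  702 * G + 1480 * G            ≡⟨ sym (*-distribʳ-+ G 702 1480) ⟩
  -- Seven levels above `κ` give enough room, as `3 ^ 7` is 2187.
  2182 * G                      ≤⟨ *-monoˡ-≤ G (≤-eval {2182} {3 ^ 7}) ⟩
  3 ^ 7 * G                     ≡⟨ sym (^-distribˡ-+-* 3 7 κ) ⟩
  3 ^ (7 + κ)                   ≤⟨ ^-monoʳ-≤ 3 7+κ≤h ⟩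
  3 ^ h                         ∎
  where
  open ≤-Reasoning
  G = 3 ^ κ

large-red-component : ∀ h t κ → κ ≡ suc t * 7 → 7 + κ ≤ h → (P : PartitionSequence (3 ^ h)) →
                      ∃[ k ] (k < 3 ^ h × HasRedComponentOfSize (A3 h) P k t)
large-red-component h t κ κ≡ le P =
  Sequence.RedComponent.stage h P t κ κ≡ (≤-trans (+-monoˡ-≤ κ (≤-eval {5} {7})) le) (fits-power h κ le)

theorem17 : ∃[ p ] ∃[ q ] ∃[ h₀ ] (0 < p × 0 < q ×
    (∀ h → h₀ ≤ h → (P : PartitionSequence (3 ^ h)) →
    ∃[ k ] ∃[ m ] (k < 3 ^ h × HasRedComponentOfSize (A3 h) P k m ×
    p * h ≤ q * (m * ⌈log₂ h ⌉))))
theorem17 = 1 , 28 , 21 , s≤s z≤n , s≤s z≤n , bound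
  where
  bound : ∀ h → 21 ≤ h → (P : PartitionSequence (3 ^ h)) →
          ∃[ k ] ∃[ m ] (k < 3 ^ h × HasRedComponentOfSize (A3 h) P k m × 1 * h ≤ 28 * (m * ⌈log₂ h ⌉))
  bound h 21≤h P with h / 7 | m/n*n≤m h 7 | m<suc[m/n]*n h 7 | /-monoˡ-≤ 7 21≤h
  -- Here `h / 7` is `t + 2`: `t + 1` scales of 7 levels each, and 7 more levels of room. From
  -- `h ≥ 21` comes `t ≥ 1`, which makes `3 + t` at most `4 * t` and explains the constant 28.
  ... | suc (suc t@(suc m)) | le | lt | _ =
    let k , k<n , component = large-red-component h t _ refl le P
    in k , t , k<n , component , (begin
      1 * h                          ≡⟨ *-identityˡ h ⟩
      h                              ≤⟨ <⇒≤ lt ⟩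
      (3 + t) * 7                    ≤⟨ *-monoˡ-≤ 7 3+t≤t*4 ⟩
      t * 4 * 7                      ≡⟨ *-assoc t 4 7 ⟩
      t * 28                         ≡⟨ *-comm t 28 ⟩
      28 * t                         ≡⟨ cong (28 *_) (sym (*-identityʳ t)) ⟩
      -- The bound is linear at this point; the logarithm enters as a factor of at least 1.
      28 * (t * 1)                   ≤⟨ *-monoʳ-≤ 28 (*-monoʳ-≤ t 1≤log) ⟩
      28 * (t * ⌈log₂ h ⌉)           ∎)
    where
    open ≤-Reasoning
    1≤log : 1 ≤ ⌈log₂ h ⌉
    1≤log = ⌈log₂⌉-mono-≤ {2} (≤-trans (s≤s (s≤s z≤n)) 21≤h)
    3+t≤t*4 : 3 + t ≤ t * 4
    3+t≤t*4 = s≤s (s≤s (s≤s (s≤s (m≤m*n m 4))))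
  ... | suc zero | _ | _ | s≤s ()
  ... | suc (suc zero) | _ | _ | s≤s (s≤s ())
  ... | zero | _ | _ | ()
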